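{- Let $G$ be a graph. Then $G$ is a hereditary $n$-convex geometry (that is, every induced subgraph $H$ of $G$, including $G$ itself, is an $n$-convex geometry with respect to its own neighbourhood convexity $n_H$) if and only if $G$ is isomorphic to $K_1$ or to $2K_1$.
   Context: All graphs are finite, simple and undirected, with non-empty vertex set (so induced subgraphs are on non-empty vertex subsets). $K_1$ is the graph with one vertex and $2K_1$ is the graph with two vertices and no edges. For a graph $G=(V,E)$ and $x\in V$, the closed neighbourhood of $x$ is $N[x]=\{x\}\cup\{y\in V:\{x,y\}\in E\}$. For $Y\subseteq V$, the common closed neighbourhood is $N[Y]=\bigcap_{y\in Y}N[y]$ if $Y\neq\varnothing$, and $N[\varnothing]=V$. The neighbourhood convexity of $G$ is the family $n_G=\{N[Y]:Y\subseteq V\}\cup\{\varnothing\}$ of subsets of $V$; it contains $\varnothing$ and $V$ and is closed under intersection. Its members are called $n$-convex sets. For $X\subseteq V$ the convex hull $[X]_{n}$ is the intersection of all $n$-convex sets containing $X$. For an $n$-convex set $K$, $\operatorname{ex}(K)=\{x\in K: K\setminus\{x\}\in n_G\}$ is the set of extreme points of $K$. $G$ is an $n$-convex geometry if $K=[\operatorname{ex}(K)]_{n}$ for every $n$-convex set $K$. -}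

module Defs where

open import Data.Bool.Base using (Bool; T)
open import Data.Bool.Properties using (T?; T-irrelevant)
open import Data.Empty using (⊥)
open import Data.Fin.Base using (Fin; zero)
import Data.Fin.Properties as Fin
open import Data.List.Base using (List; []; _∷_; allFin)
open import Data.List.Membership.Propositional renaming (_∈_ to _∈ˡ_) using ()
open import Data.List.Membership.Propositional.Properties using (∈-allFin)
open import Data.List.Relation.Unary.Any using (here; there)
open import Data.Nat.Base using (ℕ; suc; NonZero)
open import Data.Product.Base using (Σ; ∃; _×_; _,_; proj₁)
open import Data.Product.Properties using (≡-dec)
open import Data.Sum.Base using (_⊎_)
open import Function.Base using (_∘_; _on_)
open import Function.Bundles using (_↔_; _⇔_; Inverse)
open import Level using (Level; 0ℓ; _⊔_) renaming (suc to lsuc)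
open import Relation.Binary.Core using (Rel)
open import Relation.Binary.Definitions using (Decidable; DecidableEquality; Irreflexive; Symmetric)
open import Relation.Binary.PropositionalEquality using (_≡_; refl; cong)
open import Relation.Nullary using (yes; no; contradiction)
open import Relation.Unary using (Pred; _∈_; _⊆_; _≐_; _∪_; _∖_; ∅; ｛_｝)

-- Finiteness of V is decidable equality together with an exhaustive list
-- (possibly with repetitions) of the vertices.
record Graph (ℓ : Level) : Set (lsuc ℓ) where
  field
    V        : Set ℓ
    _≟_      : DecidableEquality V
    vertices : List V
    complete : ∀ x → x ∈ˡ vertices
    nonempty : V
    Adj      : Rel V ℓ
    adj?     : Decidable Adj
    irrefl   : Irreflexive _≡_ Adj
    sym      : Symmetric Adj

-- On a finite set these are classically all the subsets.  Being proof-irrelevant,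
-- T ∘ W makes ∃ (T ∘ W) the set of members of W without repetition.
Subset : ∀ {ℓ} → Set ℓ → Set ℓ
Subset V = V → Bool

module _ {ℓ} {V : Set ℓ} (W : Subset V) where

  restrict : List V → List (∃ (T ∘ W))
  restrict []       = []
  restrict (x ∷ xs) with T? (W x)
  ... | yes x∈W = (x , x∈W) ∷ restrict xs
  ... | no  _   = restrict xs

  ∈-restrict : ∀ {x} (x∈W : T (W x)) {xs} → x ∈ˡ xs → (x , x∈W) ∈ˡ restrict xs
  ∈-restrict x∈W {y ∷ _} x∈xs with T? (W y) | x∈xs
  ... | yes y∈W | here refl  = here (cong (_ ,_) (T-irrelevant x∈W y∈W))
  ... | yes _   | there x∈ys = there (∈-restrict x∈W x∈ys)
  ... | no  y∉W | here refl  = contradiction x∈W y∉W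
  ... | no  _   | there x∈ys = ∈-restrict x∈W x∈ys

induced : ∀ {ℓ} (G : Graph ℓ) (W : Subset (Graph.V G)) → ∃ (T ∘ W) → Graph ℓ
induced G W w = record
  { V        = ∃ (T ∘ W)
  ; _≟_      = ≡-dec _≟_ (λ p q → yes (T-irrelevant p q))
  ; vertices = restrict W vertices
  ; complete = λ (x , x∈W) → ∈-restrict W x∈W (complete x)
  ; nonempty = w
  ; Adj      = Adj on proj₁
  ; adj?     = λ x y → adj? (proj₁ x) (proj₁ y)
  ; irrefl   = irrefl ∘ cong proj₁
  ; sym      = sym
  }
  where open Graph G

module _ {ℓ} (G : Graph ℓ) where
  open Graph G

  N[_] : V → Pred V ℓ
  N[ x ] = ｛ x ｝ ∪ Adj x

  N⟦_⟧ : Subset V → Pred V ℓ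
  N⟦ Y ⟧ x = ∀ y → T (Y y) → x ∈ N[ y ]

  -- Membership in n_G; sets of vertices are compared extensionally.
  Convex : Pred V ℓ → Set ℓ
  Convex K = K ≐ ∅ ⊎ ∃ λ Y → K ≐ N⟦ Y ⟧

  hull : Pred V ℓ → Pred V (lsuc ℓ)
  hull X x = ∀ K → Convex K → X ⊆ K → x ∈ K

  ex : Pred V ℓ → Pred V ℓ
  ex K x = x ∈ K × Convex (K ∖ ｛ x ｝)

  IsConvexGeometry : Set (lsuc ℓ)
  IsConvexGeometry = ∀ K → Convex K → K ≐ hull (ex K)

-- G itself occurs, up to isomorphism, as the subgraph induced by all of V.
IsHereditaryConvexGeometry : ∀ {ℓ} → Graph ℓ → Set (lsuc ℓ)
IsHereditaryConvexGeometry G =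
  ∀ (W : Subset (Graph.V G)) (w : ∃ (T ∘ W)) → IsConvexGeometry (induced G W w)

infix 4 _≅_

_≅_ : ∀ {a b} → Graph a → Graph b → Set (a ⊔ b)
G ≅ H = Σ (G.V ↔ H.V) λ f → ∀ x y → G.Adj x y ⇔ H.Adj (Inverse.to f x) (Inverse.to f y)
  where
  module G = Graph G
  module H = Graph H

edgeless : (n : ℕ) .{{_ : NonZero n}} → Graph 0ℓ
edgeless n@(suc _) = record
  { V        = Fin n
  ; _≟_      = Fin._≟_
  ; vertices = allFin n
  ; complete = ∈-allFin
  ; nonempty = zero
  ; Adj      = λ _ _ → ⊥
  ; adj?     = λ _ _ → no λ ()
  ; irrefl   = λ _ ()
  ; sym      = λ ()
  }

K₁ : Graph 0ℓ
K₁ = edgeless 1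

2K₁ : Graph 0ℓ
2K₁ = edgeless 2

{-# OPTIONS --safe #-}
module Submission where

-- As ∅ is its own hull, the convex set V is generated by its extreme points only if
-- there is one, i.e. if V ∖ {x} is convex for some vertex x.  This fails in a K₂, where
-- every nonempty convex set is V, and in an edgeless graph with three or more vertices,
-- where the convex sets are ∅, the singletons and V.  So a hereditary n-convex geometry
-- has no edge and at most two vertices.  Conversely, in such a graph every point of a
-- convex set is extreme.

open import Defs
open import Data.Bool.Base using (true; false; T)
open import Data.Bool.Properties using (T?; T-irrelevant)
open import Data.Empty using (⊥; ⊥-elim)
open import Data.Fin.Base using (Fin; zero; suc)
import Data.List.Membership.Propositional as List
import Data.List.Relation.Unary.All as All
import Data.List.Relation.Unary.Any as Any
open import Data.Nat.Base using (suc; NonZero)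
open import Data.Product.Base using (∃; ∃₂; _×_; _,_; proj₁; proj₂)
open import Data.Sum.Base using (_⊎_; inj₁; inj₂; [_,_]′)
open import Data.Unit.Base using (tt)
open import Function.Base using (_∘_; const; id)
open import Function.Bundles using (_⇔_; _↔_; Equivalence; Injection; mk⇔; mk↔ₛ′)
open import Function.Properties.Inverse using (↔⇒↣)
open import Level using (Lift; lift; lower)
open import Relation.Binary.PropositionalEquality using (_≡_; _≢_; refl; sym; trans; cong)
open import Relation.Nullary using (Dec; yes; no; ¬_; contradiction; ¬?; _×-dec_; _⊎-dec_; _→-dec_)
open import Relation.Nullary.Decidable using (⌊_⌋; toWitness; fromWitness; map′; decidable-stable)
open import Relation.Unary using (Pred; Decidable; _∈_; _∖_; ｛_｝)

module _ {ℓ} (G : Graph ℓ) where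
  open Graph G using (V; _≟_; vertices; complete; nonempty; Adj; adj?)

  Edgeless : Set ℓ
  Edgeless = ∀ {x y : V} → ¬ Adj x y

  -- Phrased through equalities alone, without counting, so that it passes to induced subgraphs and
  -- along isomorphisms by injectivity.
  AtMostTwo : Set ℓ
  AtMostTwo = ∀ {x y z : V} → x ≢ y → x ≢ z → y ≡ z

  all-vertices? : ∀ {p} {P : Pred V p} → Decidable P → Dec (∀ x → P x)
  all-vertices? P? =
    map′ (λ all x → All.lookup all (complete x)) (λ all → All.tabulate λ _ → all _)
         (All.all? P? vertices)

  any-vertex? : ∀ {p} {P : Pred V p} → Decidable P → Dec (∃ P)
  any-vertex? P? =
    map′ Any.satisfied (λ (x , px) → List.lose (complete x) px) (Any.any? P? vertices)

  N⟦_⟧? : ∀ Y → Decidable (N⟦_⟧ G Y)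
  N⟦ Y ⟧? x = all-vertices? λ y → T? (Y y) →-dec ((y ≟ x) ⊎-dec adj? y x)

  hull-ex-⊆ : ∀ {K x} → Convex G K → x ∈ hull G (ex G K) → x ∈ K
  hull-ex-⊆ convex x∈hull = x∈hull _ convex proj₁

  ex⇒geometry : (∀ {K x} → Convex G K → x ∈ K → x ∈ ex G K) → IsConvexGeometry G
  ex⇒geometry extreme K convex =
    (λ x∈K L _ ex⊆L → ex⊆L (extreme convex x∈K)) , hull-ex-⊆ convex

  -- Here V appears as `N⟦ const false ⟧`. Testing the hull of its extreme points against the convex
  -- set ∅ refutes the absence of extreme points but exhibits none, hence the negative form.
  geometry⇒¬¬deletable :
    IsConvexGeometry G → ¬ (∀ x → ¬ Convex G (N⟦_⟧ G (const false) ∖ ｛ x ｝))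
  geometry⇒¬¬deletable geometry undeletable =
    lower (proj₁ (geometry _ (inj₂ (_ , id , id))) {nonempty} (λ _ ())
      (λ _ → Lift ℓ ⊥)
      (inj₁ (lower , λ ()))
      (λ {x} (_ , convex) → lift (undeletable x convex)))

  -- The vertex `y` keeps V ∖ {x} from being ∅; if it were some N[Y], the second hypothesis would
  -- put `x` back into it.
  undeletable : ∀ {x y} → x ≢ y →
    (∀ Y → (∀ {z} → x ≢ z → z ∈ N⟦_⟧ G Y) → x ∈ N⟦_⟧ G Y) →
    ¬ Convex G (N⟦_⟧ G (const false) ∖ ｛ x ｝)
  undeletable x≢y closed (inj₁ (⊆∅ , _))     = ⊆∅ ((λ _ ()) , x≢y)
  undeletable x≢y closed (inj₂ (Y , ⊆N , N⊆)) =
    proj₂ (N⊆ (closed Y λ x≢z → ⊆N ((λ _ ()) , x≢z))) refl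

  complete⇒¬geometry : ∀ {a b} → a ≢ b → (∀ x y → x ∈ N[_] G y) → ¬ IsConvexGeometry G
  complete⇒¬geometry {a} {b} a≢b adjacent geometry =
    -- Every N[Y] is all of V here, so it contains `x` whatever `Y` is.
    geometry⇒¬¬deletable geometry λ x → undeletable (proj₂ (other x)) λ _ _ y _ → adjacent x y
    where
    other : ∀ x → ∃ λ y → x ≢ y
    other x with x ≟ a
    ... | yes refl = b , a≢b
    ... | no  x≢a  = a , x≢a

  edgeless⇒N[]-singleton : Edgeless → ∀ {x y} → x ∈ N[_] G y → y ≡ x
  edgeless⇒N[]-singleton edgeless = [ id , ⊥-elim ∘ edgeless ]′

  edgeless-geometry⇒atMostTwo : Edgeless → IsConvexGeometry G → AtMostTwo
  edgeless-geometry⇒atMostTwo edgeless geometry {a} {b} {c} a≢b a≢c with b ≟ c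
  ... | yes b≡c = b≡c
  ... | no  b≢c = ⊥-elim (geometry⇒¬¬deletable geometry λ x →
    let y , z , x≢y , x≢z , y≢z = others x in
    -- A member `w` of `Y` would have both `y` and `z` in N[w] = {w}. So `Y` is empty and N[Y] = V
    -- contains `x`.
    undeletable x≢y λ Y N⊇ w w∈Y →
      contradiction (trans (sym (only (N⊇ x≢y w w∈Y))) (only (N⊇ x≢z w w∈Y))) y≢z)
    where
    only : ∀ {x y} → x ∈ N[_] G y → y ≡ x
    only = edgeless⇒N[]-singleton edgeless

    others : ∀ x → ∃₂ λ y z → x ≢ y × x ≢ z × y ≢ z
    others x with x ≟ a | x ≟ b
    ... | yes refl | _        = b , c , a≢b , a≢c , b≢c
    ... | no  _    | yes refl = a , c , a≢b ∘ sym , b≢c , a≢c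
    ... | no  x≢a  | no  x≢b  = a , b , x≢a , x≢b , a≢b

  edgeless∧atMostTwo⇒geometry : Edgeless → AtMostTwo → IsConvexGeometry G
  edgeless∧atMostTwo⇒geometry edgeless atMostTwo = ex⇒geometry extreme
    where
    extreme : ∀ {K x} → Convex G K → x ∈ K → x ∈ ex G K
    extreme (inj₁ (⊆∅ , _)) x∈K = ⊥-elim (⊆∅ x∈K)
    extreme {K} {x} (inj₂ (Y , K⊆N , N⊆K)) x∈K
      -- `K` is an arbitrary predicate, so the search for a second point goes through the decidable
      -- set N[Y] that it equals.
      with any-vertex? (λ y → N⟦ Y ⟧? y ×-dec ¬? (x ≟ y))
    ... | no  none = x∈K , inj₁ ((λ (y∈K , x≢y) → none (_ , K⊆N y∈K , x≢y)) , λ ())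
    -- With at most two vertices, K ∖ {x} is {y}, and without edges {y} = N[y].
    ... | yes (y , y∈N , x≢y) = x∈K , inj₂ ((λ z → ⌊ y ≟ z ⌋) , K∖x⊆N[y] , N[y]⊆K∖x)
      where
      K∖x⊆N[y] : ∀ {z} → z ∈ K ∖ ｛ x ｝ → z ∈ N⟦_⟧ G (λ w → ⌊ y ≟ w ⌋)
      K∖x⊆N[y] (_ , x≢z) w y≡w = inj₁ (trans (sym (toWitness y≡w)) (atMostTwo x≢y x≢z))

      N[y]⊆K∖x : ∀ {z} → z ∈ N⟦_⟧ G (λ w → ⌊ y ≟ w ⌋) → z ∈ K ∖ ｛ x ｝
      N[y]⊆K∖x z∈N with edgeless⇒N[]-singleton edgeless (z∈N y (fromWitness refl))
      ... | refl = N⊆K y∈N , x≢y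

proj₁-injective : ∀ {ℓ} {V : Set ℓ} {W : Subset V} {x y : ∃ (T ∘ W)} → proj₁ x ≡ proj₁ y → x ≡ y
proj₁-injective {x = _ , p} {y = _ , q} refl with T-irrelevant p q
... | refl = refl

module _ {ℓ} (G : Graph ℓ) where
  open Graph G using (V; _≟_; nonempty; irrefl)

  -- The ends of an edge induce a K₂.
  hereditary⇒edgeless : IsHereditaryConvexGeometry G → Edgeless G
  hereditary⇒edgeless hereditary {a} {b} ab =
    complete⇒¬geometry (induced G ab-set (a , a∈))
      {a , a∈} {b , b∈} (λ a≡b → irrefl (cong proj₁ a≡b) ab)
      adjacent (hereditary ab-set (a , a∈))
    where
    ab-set : Subset V
    ab-set x = ⌊ (x ≟ a) ⊎-dec (x ≟ b) ⌋

    a∈ : T (ab-set a)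
    a∈ = fromWitness (inj₁ refl)

    b∈ : T (ab-set b)
    b∈ = fromWitness (inj₂ refl)

    adjacent : ∀ x y → x ∈ N[_] (induced G ab-set (a , a∈)) y
    adjacent (x , x∈) (y , y∈) with toWitness x∈ | toWitness y∈
    ... | inj₁ refl | inj₁ refl = inj₁ (proj₁-injective refl)
    ... | inj₁ refl | inj₂ refl = inj₂ (Graph.sym G ab)
    ... | inj₂ refl | inj₁ refl = inj₂ ab
    ... | inj₂ refl | inj₂ refl = inj₁ (proj₁-injective refl)

  -- Taking all of V as the inducing set gives a copy of `G` with vertices `(x , tt)`, from which
  -- the bound is projected back.
  hereditary⇒atMostTwo : IsHereditaryConvexGeometry G → AtMostTwo G
  hereditary⇒atMostTwo hereditary x≢y x≢z =
    cong proj₁ (edgeless-geometry⇒atMostTwo (induced G (const true) (nonempty , tt))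
      (hereditary⇒edgeless hereditary) (hereditary (const true) (nonempty , tt))
      {_ , tt} {_ , tt} {_ , tt} (x≢y ∘ cong proj₁) (x≢z ∘ cong proj₁))

  edgeless∧atMostTwo⇒hereditary : Edgeless G → AtMostTwo G → IsHereditaryConvexGeometry G
  edgeless∧atMostTwo⇒hereditary edgeless atMostTwo W w =
    edgeless∧atMostTwo⇒geometry (induced G W w) edgeless
      (λ x≢y x≢z → proj₁-injective (atMostTwo (x≢y ∘ proj₁-injective) (x≢z ∘ proj₁-injective)))

  edgeless-≅ : ∀ {n} .{{_ : NonZero n}} → Edgeless G → V ↔ Fin n → G ≅ edgeless n
  -- Matching on `suc` lets `edgeless n` unfold, so that its adjacency becomes ⊥.
  edgeless-≅ {suc _} edgeless f = f , λ _ _ → mk⇔ edgeless λ ()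

  ≅⇒edgeless : ∀ {n} .{{_ : NonZero n}} → G ≅ edgeless n → Edgeless G
  ≅⇒edgeless {suc _} (_ , adj⇔) = Equivalence.to (adj⇔ _ _)

  ≅⇒atMostTwo : ∀ {b} {H : Graph b} → G ≅ H → AtMostTwo H → AtMostTwo G
  ≅⇒atMostTwo (f , _) atMostTwo x≢y x≢z =
    injective (atMostTwo (x≢y ∘ injective) (x≢z ∘ injective))
    where open Injection (↔⇒↣ f) using (injective)

  -- The two cases are decided by searching for a vertex `u` other than the given one, `nonempty`.
  edgeless∧atMostTwo⇒≅ : Edgeless G → AtMostTwo G → G ≅ K₁ ⊎ G ≅ 2K₁
  edgeless∧atMostTwo⇒≅ edgeless atMostTwo with any-vertex? G (λ x → ¬? (nonempty ≟ x))
  ... | no  none = inj₁ (edgeless-≅ edgeless (mk↔ₛ′ (const zero) (const nonempty)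
    (λ { zero → refl ; (suc ()) })
    (λ x → decidable-stable (nonempty ≟ x) λ v≢x → none (x , v≢x))))
  ... | yes (u , v≢u) = inj₂ (edgeless-≅ edgeless (mk↔ₛ′ to from to∘from from∘to))
    where
    to : V → Fin 2
    to x with nonempty ≟ x
    ... | yes _ = zero
    ... | no  _ = suc zero

    from : Fin 2 → V
    from zero       = nonempty
    from (suc zero) = u

    to∘from : ∀ i → to (from i) ≡ i
    to∘from zero with nonempty ≟ nonempty
    ... | yes _   = refl
    ... | no  v≢v = contradiction refl v≢v
    to∘from (suc zero) with nonempty ≟ u
    ... | yes v≡u = contradiction v≡u v≢u
    ... | no  _   = refl

    from∘to : ∀ x → from (to x) ≡ x
    from∘to x with nonempty ≟ x
    ... | yes v≡x = v≡x
    -- Both `u` and `x` differ from `nonempty`, so they coincide.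
    ... | no  v≢x = atMostTwo v≢u v≢x

atMostTwo-K₁ : AtMostTwo K₁
atMostTwo-K₁ {y = zero} {z = zero} _ _ = refl

atMostTwo-2K₁ : AtMostTwo 2K₁
atMostTwo-2K₁ {_}        {zero}     {zero}     _   _   = refl
atMostTwo-2K₁ {_}        {suc zero} {suc zero} _   _   = refl
atMostTwo-2K₁ {zero}     {zero}     {suc zero} x≢y _   = contradiction refl x≢y
atMostTwo-2K₁ {suc zero} {zero}     {suc zero} _   x≢z = contradiction refl x≢z
atMostTwo-2K₁ {zero}     {suc zero} {zero}     _   x≢z = contradiction refl x≢z
atMostTwo-2K₁ {suc zero} {suc zero} {zero}     x≢y _   = contradiction refl x≢y

theorem17 : ∀ {ℓ} (G : Graph ℓ) →
    IsHereditaryConvexGeometry G ⇔ (G ≅ K₁ ⊎ G ≅ 2K₁)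
theorem17 G = mk⇔
  (λ hereditary → edgeless∧atMostTwo⇒≅ G
    (hereditary⇒edgeless G hereditary) (hereditary⇒atMostTwo G hereditary))
  [ (λ iso → edgeless∧atMostTwo⇒hereditary G (≅⇒edgeless G iso)
      (≅⇒atMostTwo G {H = K₁} iso (λ {x} {y} {z} → atMostTwo-K₁ {x} {y} {z})))
  , (λ iso → edgeless∧atMostTwo⇒hereditary G (≅⇒edgeless G iso)
      (≅⇒atMostTwo G {H = 2K₁} iso atMostTwo-2K₁))
  ]′
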